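{- Let $X$, $Y$ and $Z$ be graphs. (i) If $\varphi\in\mathrm{PC}(X,Y)$ and $\psi\in\mathrm{PC}(Y,Z)$, then $\psi\circ\varphi\in\mathrm{PC}(X,Z)$. (ii) $$\mathrm{Iso}(X,Y)\subseteq\mathrm{O}(X,Y)\cap\mathrm{Com}(X,Y)\subseteq\mathrm{E}(X,Y)\cap\mathrm{Com}(X,Y)\subseteq\mathrm{LS}(X,Y)\cap\mathrm{Com}(X,Y)$$ and $$\mathrm{LS}(X,Y)\cap\mathrm{Com}(X,Y)=\mathrm{PC}(X,Y)=\mathrm{LSur}(X,Y)\cap\mathrm{Com}(X,Y)\subseteq\mathrm{Com}(X,Y).$$
   Context: All graphs are finite, undirected, simple and reflexive: a graph $X=(V_X,E_X)$ has a finite nonempty vertex set $V_X$, and $E_X$ consists of all loops $\{x\}$ ($x\in V_X$; written $\{x,x\}$) together with a (possibly empty) set of $2$-element subsets of $V_X$. A homomorphism $\varphi:X\to Y$ is a map $\varphi:V_X\to V_Y$ such that $\{x_1,x_2\}\in E_X$ implies $\{\varphi(x_1),\varphi(x_2)\}\in E_Y$ (a proper edge may be mapped to a loop). $N_X(x)=\{u\in V_X:\{x,u\}\in E_X\}$ (so $x\in N_X(x)$). The $\varphi$-cells are the nonempty fibres of $\varphi$; they form a partition of $V_X$. The following are sets of homomorphisms $\varphi:X\to Y$: - $\mathrm{Com}(X,Y)$: complete ones, i.e. $\varphi(V_X)=V_Y$ and $\varphi(E_X)=E_Y$. - $\mathrm{Iso}(X,Y)$: isomorphisms, i.e. bijective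 (on vertices) and complete. - $\mathrm{E}(X,Y)$: equitable ones, i.e. the partition $\{P_1,\dots,P_k\}$ of $V_X$ into $\varphi$-cells is equitable: for all $i,j\in\{1,\dots,k\}$ the number $|N_X(x)\cap P_j|$ is the same for all $x\in P_i$. - $\mathrm{O}(X,Y)$: orbit homomorphisms, i.e. the set of $\varphi$-cells is the set of orbits on $V_X$ of some subgroup $\mathfrak{G}\leq\mathrm{Aut}(X)$. - $\mathrm{LSur}(X,Y)$: locally surjective ones, i.e. $\varphi(N_X(x))=N_Y(\varphi(x))$ for all $x\in V_X$. - $\mathrm{LS}(X,Y)$: locally strong ones, i.e. for all $x_1,x_2\in V_X$, $\{\varphi(x_1),\varphi(x_2)\}\in E_Y$ implies that for every $\tilde x_1\in\varphi^{ -1}(\varphi(x_1))$ there exists $\tilde x_2\in\varphi^{ -1}(\varphi(x_2))$ with $\{\tilde x_1,\tilde x_2\}\in E_X$. - $\mathrm{PC}(X,Y)$: pseudo-covering ones, i.e. locally strong and surjective on vertices. -}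

module Defs where

open import Algebra.Bundles using (Group)
open import Data.Fin using (Fin)
open import Data.Fin.Properties using (_≟_)
open import Data.Fin.Subset using (Subset; _∈_; _∩_; ∣_∣; Nonempty)
open import Data.Nat using (ℕ; NonZero)
open import Data.Product using (∃; ∃₂; _×_; _,_; proj₁; proj₂)
open import Data.Vec using (tabulate)
open import Function using (_∘_; id)
open import Function.Definitions using (Surjective; Bijective)
import Function.Construct.Composition as Composition
import Function.Construct.Identity as Identity
open import Level using (Level; 0ℓ; suc; _⊔_)
open import Relation.Binary.Core using (Rel; _⇔_)
open import Relation.Binary.Definitions using (Reflexive; Symmetric; Decidable)
open import Relation.Binary.PropositionalEquality
  using (_≡_; refl; sym; trans; cong; subst₂)
open import Relation.Nullary.Decidable using (does)
open import Relation.Unary using (Pred; _≐_)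

-- A finite undirected reflexive graph.  `Edge x y` means that {x , y} belongs
-- to the edge set; symmetry of `Edge` makes the pair unordered, and {x , x}
-- is the loop at x.
record Graph : Set₁ where
  field
    order        : ℕ
    .{{nonEmpty}} : NonZero order

  V : Set
  V = Fin order

  field
    Edge      : Rel V 0ℓ
    edge?     : Decidable Edge
    edge-refl : Reflexive Edge
    edge-sym  : Symmetric Edge

  N : V → Subset order
  N x = tabulate (λ u → does (edge? x u))

open Graph public using (V; Edge; N)

record Hom (X Y : Graph) : Set where
  field
    map  : V X → V Y
    edge : ∀ {x₁ x₂} → Edge X x₁ x₂ → Edge Y (map x₁) (map x₂)

open Hom public using (map)

private
  variable
    X Y Z : Graph

idₕ : Hom X X
idₕ = record { map = id ; edge = id }

infixr 9 _∘ₕ_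

_∘ₕ_ : Hom Y Z → Hom X Y → Hom X Z
ψ ∘ₕ φ = record
  { map  = map ψ ∘ map φ
  ; edge = Hom.edge ψ ∘ Hom.edge φ
  }

fibre : Hom X Y → V Y → Subset (Graph.order X)
fibre φ y = tabulate (λ x → does (map φ x ≟ y))

Cells : (φ : Hom X Y) → Pred (Subset (Graph.order X)) 0ℓ
Cells φ P = Nonempty P × ∃ λ y → P ≡ fibre φ y

image : Hom X Y → Subset (Graph.order X) → Pred (V Y) 0ℓ
image φ S y = ∃ λ x → x ∈ S × map φ x ≡ y

-- φ(E_X), as a relation.  It is enough to match end points in the given order
-- because `Edge X` is symmetric.
edgeImage : Hom X Y → Rel (V Y) 0ℓ
edgeImage {X = X} φ y₁ y₂ =
  ∃₂ λ x₁ x₂ → Edge X x₁ x₂ × map φ x₁ ≡ y₁ × map φ x₂ ≡ y₂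

Com : (X Y : Graph) → Pred (Hom X Y) 0ℓ
Com X Y φ = Surjective _≡_ _≡_ (map φ) × (edgeImage φ ⇔ Edge Y)

Iso : (X Y : Graph) → Pred (Hom X Y) 0ℓ
Iso X Y φ = Bijective _≡_ _≡_ (map φ) × Com X Y φ

Equitable : (X : Graph) → Pred (Pred (Subset (Graph.order X)) 0ℓ) 0ℓ
Equitable X 𝒫 = ∀ {P Q} → 𝒫 P → 𝒫 Q →
  ∀ {x x′} → x ∈ P → x′ ∈ P → ∣ N X x ∩ Q ∣ ≡ ∣ N X x′ ∩ Q ∣

E : (X Y : Graph) → Pred (Hom X Y) 0ℓ
E X Y φ = Equitable X (Cells φ)

LSur : (X Y : Graph) → Pred (Hom X Y) 0ℓ
LSur X Y φ = ∀ x → image φ (N X x) ≐ (_∈ N Y (map φ x))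

LS : (X Y : Graph) → Pred (Hom X Y) 0ℓ
LS X Y φ = ∀ x₁ x₂ → Edge Y (map φ x₁) (map φ x₂) →
  ∀ x̃₁ → x̃₁ ∈ fibre φ (map φ x₁) →
  ∃ λ x̃₂ → x̃₂ ∈ fibre φ (map φ x₂) × Edge X x̃₁ x̃₂

PC : (X Y : Graph) → Pred (Hom X Y) 0ℓ
PC X Y φ = LS X Y φ × Surjective _≡_ _≡_ (map φ)

record IsSubgroup {c ℓ p : Level} (G : Group c ℓ)
                  (H : Pred (Group.Carrier G) p) : Set (c ⊔ ℓ ⊔ p) where
  open Group G using (_≈_; _∙_; ε; _⁻¹)
  field
    resp-≈    : ∀ {g h} → g ≈ h → H g → H h
    ε-closed  : H ε
    ∙-closed  : ∀ {g h} → H g → H h → H (g ∙ h)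
    ⁻¹-closed : ∀ {g} → H g → H (g ⁻¹)

Aut : Graph → Set
Aut X = ∃ (Iso X X)

infixr 8 _·_

_·_ : Aut X → V X → V X
(φ , _) · x = map φ x

private
  id-iso : Iso X X idₕ
  id-iso {X} = Identity.bijective _≡_
             , Identity.surjective _≡_
             , (λ { (_ , _ , e , refl , refl) → e })
             , (λ e → _ , _ , e , refl , refl)

  ∘-iso : {ψ : Hom Y Z} {φ : Hom X Y} →
          Iso Y Z ψ → Iso X Y φ → Iso X Z (ψ ∘ₕ φ)
  ∘-iso {Z = Z} {ψ = ψ} {φ} (bψ , _ , _ , eψ) (bφ , _ , _ , eφ) =
    b , proj₂ b , (λ { (_ , _ , e , refl , refl) → Hom.edge (ψ ∘ₕ φ) e }) , onto
    where
    b = Composition.bijective _≡_ _≡_ _≡_ bφ bψ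
    onto : ∀ {z₁ z₂} → Edge Z z₁ z₂ → edgeImage (ψ ∘ₕ φ) z₁ z₂
    onto e with eψ e
    ... | _ , _ , e′ , refl , refl with eφ e′
    ...   | _ , _ , e″ , refl , refl = _ , _ , e″ , refl , refl

  module Inverse (φ : Hom X Y) (iso : Iso X Y φ) where
    from : V Y → V X
    from y = proj₁ (proj₂ (proj₁ iso) y)

    to-from : ∀ y → map φ (from y) ≡ y
    to-from y = proj₂ (proj₂ (proj₁ iso) y) refl

    from-to : ∀ x → from (map φ x) ≡ x
    from-to x = proj₁ (proj₁ iso) (to-from (map φ x))

    hom : Hom Y X
    hom = record { map = from ; edge = reflect }
      where
      reflect : ∀ {y₁ y₂} → Edge Y y₁ y₂ → Edge X (from y₁) (from y₂)
      reflect e with proj₂ (proj₂ (proj₂ iso)) e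
      ... | x₁ , x₂ , e′ , refl , refl =
        subst₂ (Edge X) (sym (from-to x₁)) (sym (from-to x₂)) e′

    hom-iso : Iso Y X hom
    hom-iso = (inj , surj) , surj
            , (λ { (_ , _ , e , refl , refl) → Hom.edge hom e })
            , (λ e → _ , _ , Hom.edge φ e , from-to _ , from-to _)
      where
      inj : ∀ {y₁ y₂} → from y₁ ≡ from y₂ → y₁ ≡ y₂
      inj eq = trans (sym (to-from _)) (trans (cong (map φ) eq) (to-from _))
      surj : Surjective _≡_ _≡_ from
      surj x = map φ x , λ { refl → from-to x }

AutGroup : Graph → Group 0ℓ 0ℓ
AutGroup X = record
  { Carrier = Aut X
  ; _≈_     = λ g h → ∀ x → g · x ≡ h · x
  ; _∙_     = λ { (ψ , iψ) (φ , iφ) → ψ ∘ₕ φ , ∘-iso {ψ = ψ} {φ} iψ iφ }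
  ; ε       = idₕ , id-iso {X}
  ; _⁻¹     = λ { (φ , i) → Inverse.hom φ i , Inverse.hom-iso φ i }
  ; isGroup = record
    { isMonoid = record
      { isSemigroup = record
        { isMagma = record
          { isEquivalence = record
            { refl  = λ _ → refl
            ; sym   = λ p x → sym (p x)
            ; trans = λ p q x → trans (p x) (q x)
            }
          ; ∙-cong = λ {g} {_} {_} {k} p q x →
              trans (cong (g ·_) (q x)) (p (k · x))
          }
        ; assoc = λ _ _ _ _ → refl
        }
      ; identity = (λ _ _ → refl) , (λ _ _ → refl)
      }
    ; inverse = (λ { (φ , i) → Inverse.from-to φ i })
              , (λ { (φ , i) → Inverse.to-from φ i })
    ; ⁻¹-cong = λ { {φ , i} {ψ , j} p x →
        proj₁ (proj₁ i) (trans (Inverse.to-from φ i x)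
          (sym (trans (p _) (Inverse.to-from ψ j x)))) }
    }
  }

orbit : (X : Graph) → Pred (Aut X) 0ℓ → V X → Pred (V X) 0ℓ
orbit X 𝔊 x y = ∃ λ g → 𝔊 g × g · x ≡ y

Orbits : (X : Graph) → Pred (Aut X) 0ℓ → Pred (Subset (Graph.order X)) 0ℓ
Orbits X 𝔊 P = ∃ λ x → (_∈ P) ≐ orbit X 𝔊 x

O : (X Y : Graph) → Pred (Hom X Y) (suc 0ℓ)
O X Y φ = ∃ λ (𝔊 : Pred (Aut X) 0ℓ) →
  IsSubgroup (AutGroup X) 𝔊 × Cells φ ≐ Orbits X 𝔊

{-# OPTIONS --safe #-}
module Submission where

open import Algebra.Bundles using (Group)
open import Data.Fin using (Fin; zero; suc)
open import Data.Fin.Properties using (_≟_; 0≢1+n; suc-injective)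
open import Data.Fin.Subset as Subset using (Subset; inside; outside; ∣_∣; Nonempty)
  renaming (_∈_ to _∈ₛ_; _∩_ to _∩ₛ_)
open import Data.Fin.Subset.Properties
  using (x∈p∩q⁺; x∈p∩q⁻; x∈p∧x≢y⇒x∈p-y; x∈p⇒∣p-x∣<∣p∣; ⊆-antisym;
         nonempty?; Empty-unique; ∣⊥∣≡0)
open import Data.Nat using (ℕ; _≤_; z≤n)
open import Data.Nat.Properties using (≤-antisym; ≤-<-trans; <⇒≢)
open import Data.Product using (_×_; _,_; proj₁; proj₂)
open import Data.Vec using (tabulate; []; _∷_; here; there)
open import Data.Vec.Properties using (lookup∘tabulate; []=⇒lookup; lookup⇒[]=)
open import Function using (_∘_)
open import Level using (0ℓ)
open import Relation.Binary.PropositionalEquality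
  using (_≡_; refl; sym; trans; cong; subst)
open import Relation.Nullary using (Dec; yes; no; does; contradiction)
open import Relation.Nullary.Decidable using (dec-true)

open import Defs
open import Relation.Unary using (Pred; Decidable; _∈_; _∩_; _⊆_; _≐_)

private
  variable
    m n : ℕ
    X Y Z : Graph

-- The cells of an isomorphism are singletons, hence the orbits of the trivial group. If the cells
-- are the orbits of a group, an element moving `x` to `x′` preserves adjacency and each orbit `Q`,
-- so it injects N(x) ∩ Q into N(x′) ∩ Q; exchanging `x` and `x′` gives equal counts, which is
-- equitability. If the cells are equitable and the map is complete, an edge between two image
-- vertices lifts to some edge between their cells, so one vertex of the first cell has a neighbour
-- in the second; equal counts give every vertex of the first cell such a neighbour, which is local
-- strength.
--
-- For a map that is onto on vertices, local strength and local surjectivity both say that each edge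
-- at `map φ x` lifts to an edge starting at `x`. Such lifts also yield completeness, and they can
-- be performed one after the other along a composite.

does-true⇒ : {A : Set} (a? : Dec A) → does a? ≡ inside → A
does-true⇒ (yes a) _ = a

module _ {P : Pred (Fin n) 0ℓ} (P? : Decidable P) where

  ∈-tabulate⁺ : ∀ {x} → P x → x ∈ₛ tabulate (does ∘ P?)
  ∈-tabulate⁺ {x} px = lookup⇒[]= x _ (trans (lookup∘tabulate _ x) (dec-true (P? x) px))

  ∈-tabulate⁻ : ∀ {x} → x ∈ₛ tabulate (does ∘ P?) → P x
  ∈-tabulate⁻ {x} x∈ = does-true⇒ (P? x) (trans (sym (lookup∘tabulate _ x)) ([]=⇒lookup x∈))

-- Induction on `p`: each element of `p` uses up its image in `q`, and injectivity keeps the images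
-- of the later elements away from it.
∣∣-mono-injection : (f : Fin m → Fin n) → (∀ {x y} → f x ≡ f y → x ≡ y) →
  (p : Subset m) (q : Subset n) → (∀ {x} → x ∈ₛ p → f x ∈ₛ q) → ∣ p ∣ ≤ ∣ q ∣
∣∣-mono-injection f inj []            q f∈ = z≤n
∣∣-mono-injection f inj (outside ∷ p) q f∈ =
  ∣∣-mono-injection (f ∘ suc) (suc-injective ∘ inj) p q (f∈ ∘ there)
∣∣-mono-injection f inj (inside ∷ p)  q f∈ =
  ≤-<-trans (∣∣-mono-injection (f ∘ suc) (suc-injective ∘ inj) p (q Subset.- f zero)
              (λ x∈p → x∈p∧x≢y⇒x∈p-y (f∈ (there x∈p)) (0≢1+n ∘ sym ∘ inj)))
            (x∈p⇒∣p-x∣<∣p∣ (f∈ here))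

-- Turns an equality of neighbour counts into an actual neighbour: an empty `q` would have size 0,
-- while removing `x` from `p` makes it strictly smaller.
∣∣-Nonempty : {p q : Subset n} → ∣ p ∣ ≡ ∣ q ∣ → Nonempty p → Nonempty q
∣∣-Nonempty {n} {p} {q} eq (x , x∈p) with nonempty? q
... | yes q≢∅ = q≢∅
... | no  q≡∅ = contradiction
  (sym (trans eq (trans (cong ∣_∣ (Empty-unique q≡∅)) (∣⊥∣≡0 n))))
  (<⇒≢ (≤-<-trans z≤n (x∈p⇒∣p-x∣<∣p∣ x∈p)))

module _ (X : Graph) {x : V X} where

  ∈-N⁺ : ∀ {u} → Edge X x u → u ∈ₛ N X x
  ∈-N⁺ = ∈-tabulate⁺ (Graph.edge? X x)

  ∈-N⁻ : ∀ {u} → u ∈ₛ N X x → Edge X x u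
  ∈-N⁻ = ∈-tabulate⁻ (Graph.edge? X x)

module _ (φ : Hom X Y) {y : V Y} where

  ∈-fibre⁺ : ∀ {x} → map φ x ≡ y → x ∈ₛ fibre φ y
  ∈-fibre⁺ = ∈-tabulate⁺ (λ x → map φ x ≟ y)

  ∈-fibre⁻ : ∀ {x} → x ∈ₛ fibre φ y → map φ x ≡ y
  ∈-fibre⁻ = ∈-tabulate⁻ (λ x → map φ x ≟ y)

fibre-Cells : (φ : Hom X Y) (x : V X) → fibre φ (map φ x) ∈ Cells φ
fibre-Cells φ x = (x , ∈-fibre⁺ φ refl) , map φ x , refl

PC-∘ : (φ : Hom X Y) (ψ : Hom Y Z) → φ ∈ PC X Y → ψ ∈ PC Y Z → (ψ ∘ₕ φ) ∈ PC X Z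
PC-∘ {X} {Y} {Z} φ ψ (lsφ , surφ) (lsψ , surψ) = ls , sur
  where
  ls : (ψ ∘ₕ φ) ∈ LS X Z
  ls x₁ x₂ e x̃₁ x̃₁∈
    with y , y∈ , e₁ ← lsψ (map φ x₁) (map φ x₂) e (map φ x̃₁)
                         (∈-fibre⁺ ψ (∈-fibre⁻ (ψ ∘ₕ φ) x̃₁∈))
    -- The lifted endpoint `y` is only known to lie in the right `ψ`-fibre. Local strength of `φ`
    -- concerns edges between image vertices, so `y` needs a preimage before the edge can be lifted
    -- to X.
    with x , φx≡y ← surφ y
    with refl ← φx≡y refl
    with x̃₂ , x̃₂∈ , e₂ ← lsφ x̃₁ x e₁ x̃₁ (∈-fibre⁺ φ refl)
    = x̃₂ , ∈-fibre⁺ (ψ ∘ₕ φ) (trans (cong (map ψ) (∈-fibre⁻ φ x̃₂∈)) (∈-fibre⁻ ψ y∈)) , e₂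
  sur : ∀ z → _
  sur z with y , ψy≡z ← surψ z with x , φx≡y ← surφ y =
    x , λ { refl → ψy≡z (φx≡y refl) }

module _ {𝔊 : Pred (Aut X) 0ℓ} (𝔊≤ : IsSubgroup (AutGroup X) 𝔊) where
  open IsSubgroup 𝔊≤
  open Group (AutGroup X) using (_∙_; _⁻¹; inverse)

  orbit-sym : ∀ {x y} → orbit X 𝔊 x y → orbit X 𝔊 y x
  orbit-sym {x} (g , g∈ , refl) = g ⁻¹ , ⁻¹-closed g∈ , proj₁ inverse g x

  orbit-trans : ∀ {x y z} → orbit X 𝔊 x y → orbit X 𝔊 y z → orbit X 𝔊 x z
  orbit-trans (g , g∈ , refl) (h , h∈ , refl) = h ∙ g , ∙-closed h∈ g∈ , refl

  -- The group element moving x to x′ permutes the orbit Q, so it injects N(x) ∩ Q into N(x′) ∩ Q.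
  ∣N∩Q∣-mono : ∀ {P Q} → P ∈ Orbits X 𝔊 → Q ∈ Orbits X 𝔊 →
    ∀ {x x′} → x ∈ₛ P → x′ ∈ₛ P → ∣ N X x ∩ₛ Q ∣ ≤ ∣ N X x′ ∩ₛ Q ∣
  ∣N∩Q∣-mono {Q = Q} (_ , P⊆ , _) (_ , Q⊆ , ⊆Q) {x} x∈P x′∈P
    with h@(η , (inj , _) , _) , h∈ , refl ← orbit-trans (orbit-sym (P⊆ x∈P)) (P⊆ x′∈P)
    = ∣∣-mono-injection (map η) inj (N X x ∩ₛ Q) (N X (map η x) ∩ₛ Q) λ u∈ →
        let u∈N , u∈Q = x∈p∩q⁻ (N X x) Q u∈ in
        x∈p∩q⁺ (∈-N⁺ X (Hom.edge η (∈-N⁻ X u∈N)) ,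
                ⊆Q (orbit-trans (Q⊆ u∈Q) (h , h∈ , refl)))

  -- The inequality is available in both directions because `x` and `x′` play symmetric roles.
  Orbits-Equitable : Equitable X (Orbits X 𝔊)
  Orbits-Equitable P Q x∈P x′∈P =
    ≤-antisym (∣N∩Q∣-mono P Q x∈P x′∈P) (∣N∩Q∣-mono P Q x′∈P x∈P)

-- The trivial subgroup, phrased as acting as the identity so that it respects the pointwise
-- equality of `AutGroup`.
trivial : (X : Graph) → Pred (Aut X) 0ℓ
trivial X g = ∀ x → g · x ≡ x

trivial-IsSubgroup : IsSubgroup (AutGroup X) (trivial X)
trivial-IsSubgroup {X} = record
  { resp-≈    = λ g≈h g≈ε x → trans (sym (g≈h x)) (g≈ε x)
  ; ε-closed  = λ _ → refl
  ; ∙-closed  = λ {g} g≈ε h≈ε x → trans (cong (g ·_) (h≈ε x)) (g≈ε x)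
  ; ⁻¹-closed = λ {g} g≈ε x → trans (cong (g ⁻¹ ·_) (sym (g≈ε x))) (proj₁ inverse g x)
  }
  where open Group (AutGroup X) using (_⁻¹; inverse)

Iso⊆O : Iso X Y ⊆ O X Y
Iso⊆O {X} {Y} {φ} ((inj , _) , _) = trivial X , trivial-IsSubgroup , cell⇒orbit , orbit⇒cell
  where
  ε : Aut X
  ε = Group.ε (AutGroup X)

  cell⇒orbit : Cells φ ⊆ Orbits X (trivial X)
  cell⇒orbit ((x , x∈P) , y , refl) = x
    , (λ u∈P → ε , (λ _ → refl) , inj (trans (∈-fibre⁻ φ x∈P) (sym (∈-fibre⁻ φ u∈P))))
    , (λ { (g , g≈ε , refl) → subst (_∈ₛ fibre φ y) (sym (g≈ε x)) x∈P })

  orbit⇒cell : Orbits X (trivial X) ⊆ Cells φ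
  orbit⇒cell {P} (x , P⊆ , ⊆P) = (x , x∈P) , map φ x , ⊆-antisym
      (λ u∈P → let g , g≈ε , gx≡u = P⊆ u∈P in
               ∈-fibre⁺ φ (cong (map φ) (trans (sym gx≡u) (g≈ε x))))
      (λ u∈ → subst (_∈ₛ P) (sym (inj (∈-fibre⁻ φ u∈))) x∈P)
    where
    x∈P : x ∈ₛ P
    x∈P = ⊆P (ε , (λ _ → refl) , refl)

O⊆E : O X Y ⊆ E X Y
O⊆E (_ , 𝔊≤ , cell⇒orbit , _) P Q = Orbits-Equitable 𝔊≤ (cell⇒orbit P) (cell⇒orbit Q)

E∩Com⊆LS : (E X Y ∩ Com X Y) ⊆ LS X Y
E∩Com⊆LS {X} {Y} {φ} (equitable , _ , _ , onto) x₁ x₂ e x̃₁ x̃₁∈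
  with u₁ , u₂ , e′ , φu₁≡φx₁ , φu₂≡φx₂ ← onto e
  -- The lifted edge starts at `u₁`, not at the prescribed `x̃₁`; both lie in the same cell, so
  -- equitability carries the existence of a neighbour over.
  with x̃₂ , x̃₂∈ ← ∣∣-Nonempty
         (equitable (fibre-Cells φ x₁) (fibre-Cells φ x₂) (∈-fibre⁺ φ φu₁≡φx₁) x̃₁∈)
         (u₂ , x∈p∩q⁺ (∈-N⁺ X e′ , ∈-fibre⁺ φ φu₂≡φx₂))
  with x̃₂∈N , x̃₂∈Q ← x∈p∩q⁻ (N X x̃₁) _ x̃₂∈
  = x̃₂ , x̃₂∈Q , ∈-N⁻ X x̃₂∈N

PC⊆Com : PC X Y ⊆ Com X Y
PC⊆Com {X} {Y} {φ} (ls , sur) = sur , (λ { (_ , _ , e , refl , refl) → Hom.edge φ e }) , onto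
  where
  onto : ∀ {y₁ y₂} → Edge Y y₁ y₂ → edgeImage φ y₁ y₂
  onto {y₁} {y₂} e
    with x₁ , φx₁≡y₁ ← sur y₁ with refl ← φx₁≡y₁ refl
    with x₂ , φx₂≡y₂ ← sur y₂ with refl ← φx₂≡y₂ refl
    -- The chosen preimages `x₁` and `x₂` need not be adjacent; local strength replaces `x₂` by a
    -- vertex of its cell adjacent to `x₁`.
    with x̃₂ , x̃₂∈ , e′ ← ls x₁ x₂ e x₁ (∈-fibre⁺ φ refl)
    = x₁ , x̃₂ , e′ , refl , ∈-fibre⁻ φ x̃₂∈

PC⊆LSur : PC X Y ⊆ LSur X Y
PC⊆LSur {X} {Y} {φ} (ls , sur) x =
  (λ { (u , u∈N , refl) → ∈-N⁺ Y (Hom.edge φ (∈-N⁻ X u∈N)) }) , ⊇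
  where
  ⊇ : (_∈ₛ N Y (map φ x)) ⊆ image φ (N X x)
  ⊇ {y} y∈N
    with x₂ , φx₂≡y ← sur y with refl ← φx₂≡y refl
    with x̃₂ , x̃₂∈ , e ← ls x x₂ (∈-N⁻ Y y∈N) x (∈-fibre⁺ φ refl)
    = x̃₂ , ∈-N⁺ X e , ∈-fibre⁻ φ x̃₂∈

-- Local surjectivity is applied at `x̃₁` itself, whose image is that of `x₁`, so the given edge
-- already starts there.
LSur⊆LS : LSur X Y ⊆ LS X Y
LSur⊆LS {X} {Y} {φ} lsur x₁ x₂ e x̃₁ x̃₁∈
  with x̃₂ , x̃₂∈N , φx̃₂≡φx₂ ← proj₂ (lsur x̃₁)
         (∈-N⁺ Y (subst (λ y → Edge Y y (map φ x₂)) (sym (∈-fibre⁻ φ x̃₁∈)) e))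
  = x̃₂ , ∈-fibre⁺ φ φx̃₂≡φx₂ , ∈-N⁻ X x̃₂∈N

proposition5p9 : (X Y Z : Graph) →
    ((φ : Hom X Y) (ψ : Hom Y Z) → φ ∈ PC X Y → ψ ∈ PC Y Z → (ψ ∘ₕ φ) ∈ PC X Z)
    × ((Iso X Y ⊆ (O X Y ∩ Com X Y))
    × ((O X Y ∩ Com X Y) ⊆ (E X Y ∩ Com X Y))
    × ((E X Y ∩ Com X Y) ⊆ (LS X Y ∩ Com X Y)))
    × (((LS X Y ∩ Com X Y) ≐ PC X Y)
    × (PC X Y ≐ (LSur X Y ∩ Com X Y))
    × ((LSur X Y ∩ Com X Y) ⊆ Com X Y))
proposition5p9 X Y Z = PC-∘
  , ( (λ {φ} iso → Iso⊆O {X} {Y} {φ} iso , proj₂ iso)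
    , (λ {φ} (o , com) → (λ {P} {Q} → O⊆E {X} {Y} {φ} o {P} {Q}) , com)
    , (λ {φ} e∩com → E∩Com⊆LS {X} {Y} {φ} e∩com , proj₂ e∩com))
  , ( ((λ (ls , sur , _) → ls , sur) , (λ {φ} pc → proj₁ pc , PC⊆Com {X} {Y} {φ} pc))
    , ( (λ {φ} pc → PC⊆LSur {X} {Y} {φ} pc , PC⊆Com {X} {Y} {φ} pc)
      , (λ {φ} (lsur , sur , _) → LSur⊆LS {X} {Y} {φ} lsur , sur))
    , proj₂)
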